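{- The algorithm ExtRD Solver (given in the context), on input $(G,f)$ where $G=(V,E)$ is a graph of order $n=|V|$ and $f\colon V\to\{0,1,2\}$, runs in time cubic in the order of the input graph, i.e. in time $\mathcal{O}(n^3)$.
   Context: Graphs are finite, undirected and simple; $N_G(v)$ and $N_G[v]=N_G(v)\cup\{v\}$ are open and closed neighborhoods, and $N_G[U]=\bigcup_{u\in U}N_G[u]$. For $f\colon V\to\{0,1,2\}$ let $V_i(f)=\{v\in V\mid f(v)=i\}$. The algorithm ExtRD Solver decides the problem Extension Roman Domination (given $G$ and $f\colon V\to\{0,1,2\}$, is there a minimal Roman dominating function $\widetilde f$ of $G$ with $f\le\widetilde f$ pointwise; here a Roman dominating function (rdf) is a function $g\colon V\to\{0,1,2\}$ such that every $v$ with $g(v)=0$ has a neighbor $u$ with $g(u)=2$, and minimality is with respect to the pointwise order induced by $0<1<2$). On input $(G,f)$ it does the following: (i) Set $\widetilde f:=f$, $M_2:=V_2(f)$, $M:=M_2$. (ii) While $M\ne\emptyset$: choose $v\in M$; for each $u\in N_G(v)$ with $\widetilde f(u)=1$, set $\widetilde f(u):=2$ and add $u$ to $M$ and to $M_2$; then delete $v$ from $M$. (iii) For each $v\in M_2$: if $N_G(v)\subseteq N_G[M_2\setminus\{v\}]$, return "no" (and stop). (iv) For each $v\in V\setminus N_G[M_2]$, set $\widetilde f(v):=1$. (v) Return "yes". -}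

module Defs where

open import Data.Bool.Base using (Bool; true; false; not; _∧_; _∨_; if_then_else_)
open import Data.Fin.Base using (Fin)
open import Data.Fin.Patterns using (1F; 2F)
open import Data.Fin.Properties using (_≟_)
open import Data.Fin.Subset using (Subset; ⊤; ⁅_⁆; _∪_; _-_; _∈_; Empty)
open import Data.Fin.Subset.Properties using (_∈?_)
open import Data.List.Base using (List; []; _∷_)
open import Data.Nat.Base using (ℕ; suc; _+_; _≤_)
open import Data.Product.Base using (_×_; ∃₂)
open import Data.Sum.Base using (_⊎_)
open import Data.Vec.Functional using (Vector; updateAt)
open import Function.Base using (const)
open import Level using (0ℓ)
open import Relation.Binary.Core using (Rel)
open import Relation.Binary.Definitions using (Decidable; Irreflexive; Symmetric)
open import Relation.Binary.PropositionalEquality.Core using (_≡_)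
open import Relation.Nullary.Decidable.Core using (does)

record Graph (n : ℕ) : Set₁ where
  field
    Adj     : Rel (Fin n) 0ℓ
    adj?    : Decidable Adj
    symm    : Symmetric Adj
    irrefl  : Irreflexive _≡_ Adj

Label : Set
Label = Fin 3

-- `V` is the type of vertex registers. A program is a term of type
-- `∀ {V} → Com V`: being parametric in `V`, it can only touch vertices
-- through the operations below, all of which are charged for, and its
-- text cannot depend on the graph or on its order.

-- `f` is the read-only input and `f̃` the working copy.
data Array : Set where
  f f̃ : Array

-- Sets of vertices, stored as characteristic vectors. `X` is scratch
-- space for the closed neighbourhoods the algorithm compares against.
data SetVar : Set where
  M M₂ X : SetVar

data Expr (V : Set) : Set where
  lit  : Label → Expr V
  _[_] : Array → V → Expr V

data Test (V : Set) : Set where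
  _≐_   : Expr V → Label → Test V
  _∈ᵗ_  : V → SetVar → Test V
  _~_   : V → V → Test V
  _≈ᵗ_  : V → V → Test V
  ¬ᵗ_   : Test V → Test V
  _∧ᵗ_  : Test V → Test V → Test V
  _∨ᵗ_  : Test V → Test V → Test V

infix  9 _[_]
infix  8 _≐_ _∈ᵗ_ _~_ _≈ᵗ_
infix  7 ¬ᵗ_
infixr 6 _∧ᵗ_
infixr 5 _∨ᵗ_

data Com (V : Set) : Set where
  skip    : Com V
  _⨾_     : Com V → Com V → Com V
  cond    : Test V → Com V → Com V → Com V
  f̃[_]≔_  : V → Expr V → Com V
  insert  : V → SetVar → Com V
  delete  : V → SetVar → Com V
  -- Run the body once for every vertex, in an arbitrary order.
  foreach : (V → Com V) → Com V
  -- `search t p q` scans the vertices in an arbitrary order. At the first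
  -- `v` satisfying `t` it stops scanning and runs `p v`; if there is no
  -- such `v` it runs `q`.
  search  : (V → Test V) → (V → Com V) → Com V → Com V
  -- While some vertex satisfies the test, choose one and run the body on it.
  while∃  : (V → Test V) → (V → Com V) → Com V
  -- Stop the whole program with answer "yes" (`true`) or "no" (`false`).
  return  : Bool → Com V

infixr 4 _⨾_
infix  5 f̃[_]≔_

module _ {V : Set} where

  when unless : Test V → Com V → Com V
  when   t c = cond t c skip
  unless t c = cond t skip c

  -- S := { v | t v }, provided `t` does not mention `S`
  assign : SetVar → (V → Test V) → Com V
  assign S t = foreach λ v → cond (t v) (insert v S) (delete v S)

  -- X := N[{ w | t w }], provided `t` does not mention `X`
  X≔N[_] : (V → Test V) → Com V
  X≔N[ t ] =
    foreach (λ u → delete u X) ⨾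
    foreach λ w → when (t w)
      (foreach λ u → when (u ≈ᵗ w ∨ᵗ w ~ u) (insert u X))

  initialise : Com V
  initialise =
    foreach (λ v → f̃[ v ]≔ f [ v ]) ⨾
    assign M₂ (λ v → f [ v ] ≐ 2F) ⨾
    assign M (λ v → v ∈ᵗ M₂)

  propagate : Com V
  propagate = while∃ (λ v → v ∈ᵗ M) λ v →
    foreach (λ u → when (v ~ u ∧ᵗ f̃ [ u ] ≐ 1F)
      (f̃[ u ]≔ lit 2F ⨾ insert u M ⨾ insert u M₂)) ⨾
    delete v M

  -- Answers "no" when N(v) ⊆ N[M₂ ∖ {v}] for some v ∈ M₂, i.e. when the
  -- search for a vertex of N(v) outside N[M₂ ∖ {v}] fails.
  checkPrivate : Com V
  checkPrivate = foreach λ v → when (v ∈ᵗ M₂)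
    (X≔N[ (λ w → w ∈ᵗ M₂ ∧ᵗ ¬ᵗ w ≈ᵗ v) ] ⨾
     search (λ u → v ~ u ∧ᵗ ¬ᵗ u ∈ᵗ X) (λ _ → skip) (return false))

  complete : Com V
  complete =
    X≔N[ (λ w → w ∈ᵗ M₂) ] ⨾
    foreach λ v → unless (v ∈ᵗ X) (f̃[ v ]≔ lit 1F)

  extRDSolver : Com V
  extRDSolver =
    initialise ⨾ propagate ⨾ checkPrivate ⨾ complete ⨾ return true

-- One unit for every literal, array access, set-membership test or update,
-- label or vertex comparison, adjacency query, Boolean connective and
-- control-flow step.

exprCost : ∀ {V} → Expr V → ℕ
exprCost (lit _)   = 1
exprCost (_ [ _ ]) = 1

testCost : ∀ {V} → Test V → ℕ
testCost (e ≐ _)  = suc (exprCost e)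
testCost (_ ∈ᵗ _) = 1
testCost (_ ~ _)  = 1
testCost (_ ≈ᵗ _) = 1
testCost (¬ᵗ t)   = suc (testCost t)
testCost (s ∧ᵗ t) = suc (testCost s + testCost t)
testCost (s ∨ᵗ t) = suc (testCost s + testCost t)

record Memory (n : ℕ) : Set where
  field
    labels      : Vector Label n
    mSet m₂Set  : Subset n
    xSet        : Subset n

module _ {n : ℕ} where
  open Memory

  lookupSet : SetVar → Memory n → Subset n
  lookupSet M  = mSet
  lookupSet M₂ = m₂Set
  lookupSet X  = xSet

  modifySet : SetVar → (Subset n → Subset n) → Memory n → Memory n
  modifySet M  g σ = record σ { mSet  = g (mSet σ) }
  modifySet M₂ g σ = record σ { m₂Set = g (m₂Set σ) }
  modifySet X  g σ = record σ { xSet  = g (xSet σ) }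

  writeLabel : Fin n → Label → Memory n → Memory n
  writeLabel v i σ = record σ { labels = updateAt (labels σ) v (const i) }

-- Loops in progress carry the set of vertices still to be visited.
data Task (n : ℕ) : Set where
  run       : Com (Fin n) → Task n
  visiting  : Subset n → (Fin n → Com (Fin n)) → Task n
  searching : Subset n → (Fin n → Test (Fin n)) →
              (Fin n → Com (Fin n)) → Com (Fin n) → Task n

data Config (n : ℕ) : Set where
  ⟨_,_⟩  : List (Task n) → Memory n → Config n
  halted : Bool → Memory n → Config n

data Halted {n : ℕ} : Config n → Set where
  halted : ∀ a σ → Halted (halted a σ)

start : ∀ {n} → Com (Fin n) → Memory n → Config n
start c σ = ⟨ run c ∷ [] , σ ⟩

module Execution {n : ℕ} (G : Graph n) (input : Vector Label n) where
  open Graph G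
  open Memory

  evalExpr : Memory n → Expr (Fin n) → Label
  evalExpr σ (lit i)    = i
  evalExpr σ (f  [ v ]) = input v
  evalExpr σ (f̃  [ v ]) = labels σ v

  evalTest : Memory n → Test (Fin n) → Bool
  evalTest σ (e ≐ i)  = does (evalExpr σ e ≟ i)
  evalTest σ (v ∈ᵗ S) = does (v ∈? lookupSet S σ)
  evalTest σ (u ~ v)  = does (adj? u v)
  evalTest σ (u ≈ᵗ v) = does (u ≟ v)
  evalTest σ (¬ᵗ t)   = not (evalTest σ t)
  evalTest σ (s ∧ᵗ t) = evalTest σ s ∧ evalTest σ t
  evalTest σ (s ∨ᵗ t) = evalTest σ s ∨ evalTest σ t

  infix 3 _⟶⟨_⟩_ _⟶*⟨_⟩_

  data _⟶⟨_⟩_ : Config n → ℕ → Config n → Set where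
    skip : ∀ {K σ} →
      ⟨ run skip ∷ K , σ ⟩ ⟶⟨ 1 ⟩ ⟨ K , σ ⟩

    seq : ∀ {c d K σ} →
      ⟨ run (c ⨾ d) ∷ K , σ ⟩ ⟶⟨ 1 ⟩ ⟨ run c ∷ run d ∷ K , σ ⟩

    cond : ∀ {t c d K σ} →
      ⟨ run (cond t c d) ∷ K , σ ⟩ ⟶⟨ suc (testCost t) ⟩
      ⟨ run (if evalTest σ t then c else d) ∷ K , σ ⟩

    write : ∀ {v e K σ} →
      ⟨ run (f̃[ v ]≔ e) ∷ K , σ ⟩ ⟶⟨ suc (exprCost e) ⟩
      ⟨ K , writeLabel v (evalExpr σ e) σ ⟩

    insert : ∀ {v S K σ} →
      ⟨ run (insert v S) ∷ K , σ ⟩ ⟶⟨ 1 ⟩ ⟨ K , modifySet S (_∪ ⁅ v ⁆) σ ⟩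

    delete : ∀ {v S K σ} →
      ⟨ run (delete v S) ∷ K , σ ⟩ ⟶⟨ 1 ⟩ ⟨ K , modifySet S (_- v) σ ⟩

    foreach : ∀ {b K σ} →
      ⟨ run (foreach b) ∷ K , σ ⟩ ⟶⟨ 1 ⟩ ⟨ visiting ⊤ b ∷ K , σ ⟩

    visit : ∀ {R b v K σ} → v ∈ R →
      ⟨ visiting R b ∷ K , σ ⟩ ⟶⟨ 1 ⟩
      ⟨ run (b v) ∷ visiting (R - v) b ∷ K , σ ⟩

    visited : ∀ {R b K σ} → Empty R →
      ⟨ visiting R b ∷ K , σ ⟩ ⟶⟨ 1 ⟩ ⟨ K , σ ⟩

    search : ∀ {t p q K σ} →
      ⟨ run (search t p q) ∷ K , σ ⟩ ⟶⟨ 1 ⟩ ⟨ searching ⊤ t p q ∷ K , σ ⟩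

    probe : ∀ {R t p q v K σ} → v ∈ R →
      ⟨ searching R t p q ∷ K , σ ⟩ ⟶⟨ suc (testCost (t v)) ⟩
      ⟨ (if evalTest σ (t v) then run (p v) else searching (R - v) t p q) ∷ K , σ ⟩

    exhausted : ∀ {R t p q K σ} → Empty R →
      ⟨ searching R t p q ∷ K , σ ⟩ ⟶⟨ 1 ⟩ ⟨ run q ∷ K , σ ⟩

    while∃ : ∀ {t b K σ} →
      ⟨ run (while∃ t b) ∷ K , σ ⟩ ⟶⟨ 1 ⟩
      ⟨ run (search t (λ v → b v ⨾ while∃ t b) skip) ∷ K , σ ⟩

    return : ∀ {a K σ} →
      ⟨ run (return a) ∷ K , σ ⟩ ⟶⟨ 1 ⟩ halted a σ

  data _⟶*⟨_⟩_ : Config n → ℕ → Config n → Set where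
    done : ∀ {c} → c ⟶*⟨ 0 ⟩ c
    step : ∀ {c c′ c″ j k} →
      c ⟶⟨ j ⟩ c′ → c′ ⟶*⟨ k ⟩ c″ → c ⟶*⟨ j + k ⟩ c″

  -- Every execution from `c`, however the vertices are chosen, reaches
  -- `halted` at total cost at most `k`: no partial execution costs more, and
  -- each one that has not halted can be continued. As every step costs at
  -- least 1, this excludes infinite executions.
  HaltsWithin : ℕ → Config n → Set
  HaltsWithin k c = ∀ {j c′} → c ⟶*⟨ j ⟩ c′ →
    j ≤ k × (Halted c′ ⊎ ∃₂ λ i c″ → c′ ⟶⟨ i ⟩ c″)

{-# OPTIONS --safe #-}

-- The only loop without an a priori bound on its number of rounds is the one
-- that empties M. There |M| + |{u | f̃(u) = 1}| works as a potential: promoting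
-- a vertex u from 1 to 2 pays for inserting u into M, and each round ends by
-- removing an element of M. Whatever the initial memory, this potential is at
-- most 2n, so the loop makes at most 2n rounds of linear cost. The other phases
-- are loops nested to depth at most three.

module Submission where

open import Data.Bool.Base using (true; false; _∧_; if_then_else_)
open import Data.Fin.Base using (Fin)
open import Data.Fin.Patterns using (1F; 2F)
open import Data.Fin.Properties using (_≟_)
open import Data.Fin.Subset using (Subset; inside; outside; ⁅_⁆; _∪_; _-_; _∈_; _⊆_; ∣_∣)
open import Data.Fin.Subset.Properties
  using (_∈?_; nonempty?; ∣p∣≤n; ∣⊤∣≡n; ∣⁅x⁆∣≡1; p⊆q⇒∣p∣≤∣q∣; p⊆p∪q; x∈p⇒∣p-x∣<∣p∣; x∈p∧x≢y⇒x∈p-y)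
open import Data.List.Base using (_∷_)
open import Data.Nat.Base using (ℕ; suc; _+_; _*_; _^_; _≤_; _<_; z≤n; s≤s)
open import Data.Nat.Properties
  using (≤-refl; ≤-reflexive; ≤-trans; <-≤-trans; n≤1+n; m≤m+n; m≤n+m; +-comm; +-assoc; +-suc;
         +-mono-≤; +-monoˡ-≤; +-monoʳ-≤; +-monoˡ-<; +-identityʳ; *-monoʳ-≤; ^-monoʳ-≤; module ≤-Reasoning)
open import Data.Nat.Tactic.RingSolver using (solve-∀)
open import Data.Product.Base using (_×_; _,_; ∃; ∃₂)
open import Data.Sum.Base using (inj₁; inj₂)
open import Data.Unit.Base using (tt)
open import Data.Vec.Base using ([]; _∷_; tabulate)
open import Data.Vec.Functional using (Vector)
open import Data.Vec.Functional.Properties using (updateAt-updates; updateAt-minimal)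
open import Data.Vec.Properties using ([]=⇒lookup; lookup⇒[]=; lookup∘tabulate)
open import Defs
open import Function.Base using (id)
open import Relation.Binary.PropositionalEquality.Core using (_≡_; refl; sym; trans; cong)
open import Relation.Nullary.Decidable using (Dec; does; yes; no; dec-true)
open import Relation.Nullary.Negation using (contradiction)
open import Relation.Unary using (U; ∅)

-- Booleans and cardinalities of subsets

does⇒ : ∀ {A : Set} (a? : Dec A) → does a? ≡ true → A
does⇒ (yes a) _ = a

∧-true⁻ʳ : ∀ b {c} → b ∧ c ≡ true → c ≡ true
∧-true⁻ʳ true c≡true = c≡true

∣p∪q∣≤∣p∣+∣q∣ : ∀ {n} (p q : Subset n) → ∣ p ∪ q ∣ ≤ ∣ p ∣ + ∣ q ∣
∣p∪q∣≤∣p∣+∣q∣ []            []            = z≤n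
∣p∪q∣≤∣p∣+∣q∣ (outside ∷ p) (outside ∷ q) = ∣p∪q∣≤∣p∣+∣q∣ p q
∣p∪q∣≤∣p∣+∣q∣ (outside ∷ p) (inside  ∷ q) =
  ≤-trans (s≤s (∣p∪q∣≤∣p∣+∣q∣ p q)) (≤-reflexive (sym (+-suc ∣ p ∣ ∣ q ∣)))
∣p∪q∣≤∣p∣+∣q∣ (inside  ∷ p) (outside ∷ q) = s≤s (∣p∪q∣≤∣p∣+∣q∣ p q)
∣p∪q∣≤∣p∣+∣q∣ (inside  ∷ p) (inside  ∷ q) =
  s≤s (≤-trans (∣p∪q∣≤∣p∣+∣q∣ p q) (+-monoʳ-≤ ∣ p ∣ (n≤1+n ∣ q ∣)))

∣p∪⁅x⁆∣≤1+∣p∣ : ∀ {n} (p : Subset n) x → ∣ p ∪ ⁅ x ⁆ ∣ ≤ suc ∣ p ∣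
∣p∪⁅x⁆∣≤1+∣p∣ p x = begin
  ∣ p ∪ ⁅ x ⁆ ∣     ≤⟨ ∣p∪q∣≤∣p∣+∣q∣ p ⁅ x ⁆ ⟩
  ∣ p ∣ + ∣ ⁅ x ⁆ ∣  ≡⟨ cong (∣ p ∣ +_) (∣⁅x⁆∣≡1 x) ⟩
  ∣ p ∣ + 1         ≡⟨ +-comm ∣ p ∣ 1 ⟩
  suc ∣ p ∣         ∎
  where open ≤-Reasoning

-- The potential and the effect of a promotion on it

module _ {n : ℕ} where
  open Memory

  ones : Memory n → Subset n
  ones σ = tabulate λ u → does (labels σ u ≟ 1F)

  ∈ones⁺ : ∀ σ {u} → labels σ u ≡ 1F → u ∈ ones σ
  ∈ones⁺ σ {u} eq = lookup⇒[]= u (ones σ)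
    (trans (lookup∘tabulate _ u) (dec-true (labels σ u ≟ 1F) eq))

  ∈ones⁻ : ∀ σ {u} → u ∈ ones σ → labels σ u ≡ 1F
  ∈ones⁻ σ {u} u∈ = does⇒ (labels σ u ≟ 1F)
    (trans (sym (lookup∘tabulate _ u)) ([]=⇒lookup u∈))

  -- The vertex `u` now carries 2 and every other label is untouched.
  ones-writeLabel-2F : ∀ σ u → ones (writeLabel u 2F σ) ⊆ ones σ - u
  ones-writeLabel-2F σ u {w} w∈ with w ≟ u | ∈ones⁻ (writeLabel u 2F σ) w∈
  ... | yes refl | eq = contradiction
    (trans (sym (updateAt-updates u (labels σ))) eq) λ ()
  ... | no w≢u   | eq = x∈p∧x≢y⇒x∈p-y
    (∈ones⁺ σ (trans (sym (updateAt-minimal w u (labels σ) w≢u)) eq)) w≢u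

  potential : Memory n → ℕ
  potential σ = ∣ mSet σ ∣ + ∣ ones σ ∣

  potential≤2n : ∀ σ → potential σ ≤ n + n
  potential≤2n σ = +-mono-≤ (∣p∣≤n (mSet σ)) (∣p∣≤n (ones σ))

  promote : Fin n → Memory n → Memory n
  promote u σ = modifySet M (_∪ ⁅ u ⁆) (writeLabel u 2F σ)

  -- `M` gains at most one element, none if `u` was already there, while `ones` loses `u`, which
  -- belonged to it by hypothesis.
  potential-promote : ∀ σ u → labels σ u ≡ 1F → potential (promote u σ) ≤ potential σ
  potential-promote σ u σu≡1 = begin
    ∣ mSet σ ∪ ⁅ u ⁆ ∣ + ∣ ones (writeLabel u 2F σ) ∣
      ≤⟨ +-mono-≤ (∣p∪⁅x⁆∣≤1+∣p∣ (mSet σ) u) (p⊆q⇒∣p∣≤∣q∣ (ones-writeLabel-2F σ u)) ⟩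
    suc ∣ mSet σ ∣ + ∣ ones σ - u ∣
      ≡⟨ +-suc ∣ mSet σ ∣ _ ⟨
    ∣ mSet σ ∣ + suc ∣ ones σ - u ∣
      ≤⟨ +-monoʳ-≤ ∣ mSet σ ∣ (x∈p⇒∣p-x∣<∣p∣ (∈ones⁺ σ σu≡1)) ⟩
    ∣ mSet σ ∣ + ∣ ones σ ∣  ∎
    where open ≤-Reasoning

-- Termination within a budget

module _ {n : ℕ} (G : Graph n) (input : Vector Label n) where
  open Execution G input
  open Memory

  -- An inductive form of `HaltsWithin` that can be built along the program: some step exists, and
  -- every possible step leaves enough budget for what follows, so all orders of choosing vertices
  -- are covered.
  data Terminates (k : ℕ) : Config n → Set where
    halt : ∀ {a σ} → Terminates k (halted a σ)
    next : ∀ {c} → ∃₂ (λ i c′ → c ⟶⟨ i ⟩ c′) →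
           (∀ {i c′} → c ⟶⟨ i ⟩ c′ → ∃ λ j → i + j ≤ k × Terminates j c′) →
           Terminates k c

  terminates⇒haltsWithin : ∀ {k c} → Terminates k c → HaltsWithin k c
  terminates⇒haltsWithin halt         done         = z≤n , inj₁ (halted _ _)
  terminates⇒haltsWithin (next s _)   done         = z≤n , inj₂ s
  terminates⇒haltsWithin halt         (step () _)
  terminates⇒haltsWithin (next _ all) (step {j = i} s ss) with all s
  ... | j , i+j≤k , t with terminates⇒haltsWithin t ss
  ...   | j′≤j , progress = ≤-trans (+-monoʳ-≤ i j′≤j) i+j≤k , progress

  Terminates-mono : ∀ {j k c} → j ≤ k → Terminates j c → Terminates k c
  Terminates-mono j≤k halt         = halt
  Terminates-mono j≤k (next s all) = next s λ s′ →
    let i , i+j≤ , t = all s′ in i , ≤-trans i+j≤ j≤k , t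

  -- A total-correctness triple: from `σ`, the task takes time at most `k` and
  -- either ends the whole program or hands over a memory satisfying `Q`.
  record Takes (τ : Task n) (σ : Memory n) (k : ℕ) (Q : Memory n → Set) : Set where
    field
      andThen : ∀ {K m} → (∀ {σ′} → Q σ′ → Terminates m ⟨ K , σ′ ⟩) →
                Terminates (k + m) ⟨ τ ∷ K , σ ⟩
  open Takes

  private variable
    σ     : Memory n
    τ     : Task n
    b     : Fin n → Com (Fin n)
    c d   : Com (Fin n)
    e     : Expr (Fin n)
    i k l : ℕ
    P Q   : Memory n → Set
    R     : Subset n
    S     : SetVar
    t     : Test (Fin n)
    s     : Fin n → Test (Fin n)
    v     : Fin n

  -- Cost rules for the commands

  takes-conseq : k ≤ l → (∀ {σ′} → P σ′ → Q σ′) → Takes τ σ k P → Takes τ σ l Q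
  takes-conseq k≤l P⇒Q T .andThen κ =
    Terminates-mono (+-monoˡ-≤ _ k≤l) (T .andThen λ p → κ (P⇒Q p))

  takes-≡ : k ≡ l → Takes τ σ k Q → Takes τ σ l Q
  takes-≡ k≡l = takes-conseq (≤-reflexive k≡l) id

  takes-skip : Q σ → Takes (run skip) σ 1 Q
  takes-skip q .andThen κ = next (_ , _ , skip) λ { skip → _ , ≤-refl , κ q }

  -- Halting discards the stack, so the continuation is never entered and any `Q` is allowed.
  takes-return : ∀ {a} → Takes (run (return a)) σ 1 Q
  takes-return .andThen κ = next (_ , _ , return) λ { return → 0 , s≤s z≤n , halt }

  takes-write : Q (writeLabel v (evalExpr σ e) σ) →
                Takes (run (f̃[ v ]≔ e)) σ (suc (exprCost e)) Q
  takes-write q .andThen κ = next (_ , _ , write) λ { write → _ , ≤-refl , κ q }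

  takes-insert : Q (modifySet S (_∪ ⁅ v ⁆) σ) → Takes (run (insert v S)) σ 1 Q
  takes-insert q .andThen κ = next (_ , _ , insert) λ { insert → _ , ≤-refl , κ q }

  takes-delete : Q (modifySet S (_- v) σ) → Takes (run (delete v S)) σ 1 Q
  takes-delete q .andThen κ = next (_ , _ , delete) λ { delete → _ , ≤-refl , κ q }

  takes-⨾ : Takes (run c) σ k P → (∀ {σ′} → P σ′ → Takes (run d) σ′ l Q) →
            Takes (run (c ⨾ d)) σ (1 + k + l) Q
  takes-⨾ {k = k} {l = l} C D .andThen {m = m} κ = next (_ , _ , seq) λ
    { seq → _ , ≤-reflexive (cong suc (sym (+-assoc k l m)))
          , C .andThen λ p → D p .andThen κ }

  -- Adding the costs of the branches, instead of taking their maximum, keeps all bounds polynomial.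
  takes-if : ∀ {x} → (x ≡ true → Takes (run c) σ k Q) → (x ≡ false → Takes (run d) σ l Q) →
             Takes (run (if x then c else d)) σ (k + l) Q
  takes-if {x = true}  C D = takes-conseq (m≤m+n _ _) id (C refl)
  takes-if {x = false} C D = takes-conseq (m≤n+m _ _) id (D refl)

  takes-cond : (evalTest σ t ≡ true → Takes (run c) σ k Q) →
               (evalTest σ t ≡ false → Takes (run d) σ l Q) →
               Takes (run (cond t c d)) σ (suc (testCost t) + (k + l)) Q
  takes-cond {t = t} C D .andThen κ = next (_ , _ , cond) λ
    { cond → _ , ≤-reflexive (sym (+-assoc (suc (testCost t)) _ _))
           , takes-if C D .andThen κ }

  takes-when : Q σ → (evalTest σ t ≡ true → Takes (run c) σ k Q) →
               Takes (run (when t c)) σ (suc (testCost t) + (k + 1)) Q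
  takes-when q C = takes-cond C λ _ → takes-skip q

  -- Induction on `m`, with `Q` as loop invariant. A round costs 1 for the visit and `k` for the
  -- body; the leading 1 pays for leaving the loop.
  takes-visiting : ∀ m → ∣ R ∣ ≤ m →
                   (∀ v {σ′} → Q σ′ → Takes (run (b v)) σ′ k Q) →
                   Q σ → Takes (visiting R b) σ (1 + m * (1 + k)) Q
  takes-visiting {R = R} {Q = Q} {b = b} {k = k} {σ = σ} m ∣R∣≤m B q .andThen {K = K} {m = l} κ =
    next progress (all m ∣R∣≤m)
    where
    progress : ∃₂ λ i c′ → ⟨ visiting R b ∷ K , σ ⟩ ⟶⟨ i ⟩ c′
    progress with nonempty? R
    ... | yes (v , v∈R) = _ , _ , visit v∈R
    ... | no empty      = _ , _ , visited empty

    rearrange : ∀ k m l → 1 + (k + (1 + m * (1 + k) + l)) ≡ 1 + (1 + m) * (1 + k) + l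
    rearrange = solve-∀

    all : ∀ m → ∣ R ∣ ≤ m → ∀ {i c′} → ⟨ visiting R b ∷ K , σ ⟩ ⟶⟨ i ⟩ c′ →
          ∃ λ j → i + j ≤ 1 + m * (1 + k) + l × Terminates j c′
    all m _ (visited _) = l , s≤s (m≤n+m l _) , κ q
    -- Removing `v` shrinks `R` strictly, which forces `m` to be a successor.
    all m ∣R∣≤m (visit {v = v} v∈R) with m | ≤-trans (x∈p⇒∣p-x∣<∣p∣ v∈R) ∣R∣≤m
    ... | suc m′ | s≤s ∣R-v∣≤m′ = _ , ≤-reflexive (rearrange k m′ l) ,
      B v q .andThen λ q′ → takes-visiting m′ ∣R-v∣≤m′ B q′ .andThen κ

  takes-foreach : (∀ v {σ′} → Q σ′ → Takes (run (b v)) σ′ k Q) →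
                  Q σ → Takes (run (foreach b)) σ (2 + n * (1 + k)) Q
  takes-foreach B q .andThen κ = next (_ , _ , foreach) λ
    { foreach → _ , ≤-refl , takes-visiting n (≤-reflexive (∣⊤∣≡n n)) B q .andThen κ }

  -- Probing does not change the memory, so both outcomes are analysed from the initial `σ`.
  takes-searching : ∀ m → ∣ R ∣ ≤ m → (∀ v → testCost (s v) ≤ i) →
                    (∀ v → evalTest σ (s v) ≡ true → Takes (run (b v)) σ k Q) →
                    Takes (run c) σ k Q →
                    Takes (searching R s b c) σ (1 + m * (1 + i) + k) Q
  takes-searching {R = R} {s = s} {i = i} {σ = σ} {b = b} {k = k} {c = c}
                  m ∣R∣≤m cost found notFound .andThen {K = K} {m = l} κ =
    next progress (all m ∣R∣≤m)
    where
    progress : ∃₂ λ i c′ → ⟨ searching R s b c ∷ K , σ ⟩ ⟶⟨ i ⟩ c′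
    progress with nonempty? R
    ... | yes (v , v∈R) = _ , _ , probe v∈R
    ... | no empty      = _ , _ , exhausted empty

    rearrange : ∀ i m k l → 1 + i + (1 + m * (1 + i) + k + l) ≡ 1 + (1 + m) * (1 + i) + k + l
    rearrange = solve-∀

    all : ∀ m → ∣ R ∣ ≤ m → ∀ {j c′} → ⟨ searching R s b c ∷ K , σ ⟩ ⟶⟨ j ⟩ c′ →
          ∃ λ r → j + r ≤ 1 + m * (1 + i) + k + l × Terminates r c′
    all m _ (exhausted _) = k + l , s≤s (+-monoˡ-≤ l (m≤n+m k _)) , notFound .andThen κ
    all m ∣R∣≤m (probe {v = v} v∈R) with m | ≤-trans (x∈p⇒∣p-x∣<∣p∣ v∈R) ∣R∣≤m
    ... | suc m′ | s≤s ∣R-v∣≤m′ = _ ,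
      ≤-trans (+-monoˡ-≤ (1 + m′ * (1 + i) + k + l) (s≤s (cost v)))
              (≤-reflexive (rearrange i m′ k l)) ,
      branch (evalTest σ (s v)) refl
      where
      branch : ∀ x → evalTest σ (s v) ≡ x →
               Terminates (1 + m′ * (1 + i) + k + l)
                 ⟨ (if x then run (b v) else searching (R - v) s b c) ∷ K , σ ⟩
      -- An early success leaves the budget of the remaining scan unspent.
      branch true  sv = Terminates-mono (+-monoˡ-≤ l (m≤n+m k _)) (found v sv .andThen κ)
      branch false _  = takes-searching m′ ∣R-v∣≤m′ cost found notFound .andThen κ

  takes-search : (∀ v → testCost (s v) ≤ i) →
                 (∀ v → evalTest σ (s v) ≡ true → Takes (run (b v)) σ k Q) →
                 Takes (run c) σ k Q →
                 Takes (run (search s b c)) σ (2 + n * (1 + i) + k) Q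
  takes-search cost found notFound .andThen κ = next (_ , _ , search) λ
    { search → _ , ≤-refl
             , takes-searching n (≤-reflexive (∣⊤∣≡n n)) cost found notFound .andThen κ }

  -- Induction on `m`. The strict bound `Φ σ < m` reserves one extra round for the final, failing
  -- search. The 4 is one step of unfolding, two of search overhead and one of sequencing.
  takes-while∃ : ∀ (Φ : Memory n → ℕ) → (∀ v → testCost (s v) ≤ i) →
                 (∀ v {σ} → evalTest σ (s v) ≡ true →
                   Takes (run (b v)) σ k (λ σ′ → Φ σ′ < Φ σ)) →
                 ∀ m → Φ σ < m →
                 Takes (run (while∃ s b)) σ (m * (4 + n * (1 + i) + k)) U
  takes-while∃ {i = i} {k = k} Φ cost body (suc m) (s≤s Φ≤m) .andThen {m = l} κ =
    next (_ , _ , while∃) λ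
      { while∃ → _ , ≤-reflexive (rearrange (n * (1 + i)) k (m * (4 + n * (1 + i) + k)) l)
               , takes-search cost
                   (λ v sv → takes-⨾ (body v sv) λ Φ′<Φ →
                     takes-while∃ Φ cost body m (<-≤-trans Φ′<Φ Φ≤m))
                   -- The cost of `skip` is padded to that of a full round plus recursion, since
                   -- both outcomes of the search share one bound.
                   (takes-conseq (s≤s z≤n) id (takes-skip tt)) .andThen κ }
    where
    rearrange : ∀ a k w l → 1 + (2 + a + (1 + k + w) + l) ≡ (4 + a + k) + w + l
    rearrange = solve-∀

  -- Costs of the phases of the algorithm

  takes-assign : (∀ v → testCost (s v) ≤ i) →
                 Takes (run (assign S s)) σ (2 + n * (4 + i)) U
  takes-assign {i = i} cost = takes-≡ (cong (λ a → 2 + n * (2 + a)) (+-comm i 2))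
    (takes-foreach (λ v _ → takes-conseq (s≤s (+-monoˡ-≤ 2 (cost v))) id
      (takes-cond (λ _ → takes-insert tt) (λ _ → takes-delete tt))) tt)

  -- The quadratic term charges a full inner scan to every `w`; an inner round costs 7, namely 1 for
  -- the visit, 4 for the guard and 2 for both branches.
  takes-X≔N : (∀ v → testCost (s v) ≤ i) →
              Takes (run X≔N[ s ]) σ (5 + (7 + i) * n + 7 * (n * n)) U
  takes-X≔N {i = i} cost = takes-≡ (rearrange n i)
    (takes-⨾ (takes-foreach (λ _ _ → takes-delete tt) tt) λ _ →
     takes-foreach (λ w _ → takes-conseq (s≤s (+-monoˡ-≤ _ (cost w))) id
       (takes-when tt λ _ →
         takes-foreach (λ u _ → takes-when tt λ _ → takes-insert tt) tt)) tt)
    where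
    rearrange : ∀ n i → 1 + (2 + n * 2) + (2 + n * (1 + (suc i + (2 + n * 7 + 1))))
                      ≡ 5 + (7 + i) * n + 7 * (n * n)
    rearrange = solve-∀

  takes-initialise : Takes (run initialise) σ (8 + 14 * n) U
  takes-initialise = takes-≡ (rearrange n)
    (takes-⨾ (takes-foreach (λ _ _ → takes-write tt) tt) λ _ →
     takes-⨾ (takes-assign (λ _ → ≤-refl)) λ _ →
     takes-assign (λ _ → ≤-refl))
    where
    rearrange : ∀ n → 1 + (2 + n * 3) + (1 + (2 + n * 6) + (2 + n * 5)) ≡ 8 + 14 * n
    rearrange = solve-∀

  takes-propagate : Takes (run propagate) σ (8 + 31 * n + 30 * (n * n)) U
  takes-propagate {σ = σ} = takes-≡ (rearrange n)
    -- The potential is at most `n + n`, and the failing search takes one more round.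
    (takes-while∃ potential (λ _ → ≤-refl) round (suc (n + n)) (s≤s (potential≤2n σ)))
    where
    -- Here `p` is the potential at the start of the round. Keeping `v` in `M` ensures that the
    -- closing `delete v M` lowers the potential strictly.
    Inv : Fin n → ℕ → Memory n → Set
    Inv v p σ = v ∈ mSet σ × potential σ ≤ p

    step-inv : ∀ v p u {σ} → Inv v p σ →
      Takes (run (when (v ~ u ∧ᵗ f̃ [ u ] ≐ 1F) (f̃[ u ]≔ lit 2F ⨾ insert u M ⨾ insert u M₂)))
            σ 12 (Inv v p)
    step-inv v p u {σ} inv@(v∈M , Φ≤p) = takes-when inv λ guard →
      -- The intermediate memories are tracked exactly, up to `promote u σ`; the insertion into `M₂`
      -- after that leaves the potential unchanged.
      takes-⨾ {P = writeLabel u 2F σ ≡_} (takes-write refl) λ { refl →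
      takes-⨾ {P = promote u σ ≡_} (takes-insert refl) λ { refl →
      takes-insert
        ( p⊆p∪q ⁅ u ⁆ v∈M
        , ≤-trans (potential-promote σ u
            (does⇒ (labels σ u ≟ 1F) (∧-true⁻ʳ (does (Graph.adj? G v u)) guard))) Φ≤p) } }

    round : ∀ v {σ} → evalTest σ (v ∈ᵗ M) ≡ true → Takes _ σ _ λ σ′ → potential σ′ < potential σ
    round v {σ} guard = takes-⨾
      (takes-foreach (step-inv v (potential σ)) (does⇒ (v ∈? mSet σ) guard , ≤-refl))
      λ { {σ′} (v∈M , Φ≤) → takes-delete
            (<-≤-trans (+-monoˡ-< ∣ ones σ′ ∣ (x∈p⇒∣p-x∣<∣p∣ v∈M)) Φ≤) }

    rearrange : ∀ n → suc (n + n) * (4 + n * 2 + (1 + (2 + n * 13) + 1)) ≡ 8 + 31 * n + 30 * (n * n)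
    rearrange = solve-∀

  -- The cubic term arises here: `X` is rebuilt in quadratic time for up to `n` vertices. The 11 is
  -- `7 + i` with the guard cost `i = 4`.
  takes-checkPrivate : Takes (run checkPrivate) σ (2 + 13 * n + 16 * (n * n) + 7 * (n * n * n)) U
  takes-checkPrivate = takes-≡ (rearrange n)
    (takes-foreach (λ v _ → takes-when tt λ _ →
      takes-⨾ (takes-X≔N (λ _ → ≤-refl)) λ _ →
      takes-search (λ _ → ≤-refl) (λ _ _ → takes-skip tt) takes-return) tt)
    where
    rearrange : ∀ n → 2 + n * (1 + (2 + (1 + (5 + 11 * n + 7 * (n * n)) + (2 + n * 5 + 1) + 1)))
                    ≡ 2 + 13 * n + 16 * (n * n) + 7 * (n * n * n)
    rearrange = solve-∀

  takes-complete : Takes (run complete) σ (8 + 14 * n + 7 * (n * n)) U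
  takes-complete = takes-≡ (rearrange n)
    (takes-⨾ (takes-X≔N (λ _ → ≤-refl)) λ _ →
     takes-foreach (λ _ _ → takes-cond (λ _ → takes-skip tt) (λ _ → takes-write tt)) tt)
    where
    rearrange : ∀ n → 1 + (5 + 8 * n + 7 * (n * n)) + (2 + n * 6) ≡ 8 + 14 * n + 7 * (n * n)
    rearrange = solve-∀

  -- The program never runs off its end, so any postcondition holds.
  takes-extRDSolver : Takes (run extRDSolver) σ (31 + 72 * n + 53 * (n * n) + 7 * (n * n * n)) ∅
  takes-extRDSolver = takes-≡ (rearrange n)
    (takes-⨾ takes-initialise λ _ → takes-⨾ takes-propagate λ _ →
     takes-⨾ takes-checkPrivate λ _ → takes-⨾ takes-complete λ _ → takes-return)
    where
    rearrange : ∀ n →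
      1 + (8 + 14 * n) + (1 + (8 + 31 * n + 30 * (n * n)) +
        (1 + (2 + 13 * n + 16 * (n * n) + 7 * (n * n * n)) +
          (1 + (8 + 14 * n + 7 * (n * n)) + 1)))
      ≡ 31 + 72 * n + 53 * (n * n) + 7 * (n * n * n)
    rearrange = solve-∀

  extRDSolver-haltsWithin : ∀ σ →
    HaltsWithin (31 + 72 * n + 53 * (n * n) + 7 * (n * n * n)) (start extRDSolver σ)
  extRDSolver-haltsWithin σ = terminates⇒haltsWithin
    -- Below the program lies the empty stack, which is stuck without having halted; the
    -- postcondition `∅` shows that it is never reached.
    (Terminates-mono (≤-reflexive (+-identityʳ _)) (takes-extRDSolver .andThen {m = 0} λ ()))

-- From the explicit polynomial to the cubic bound

cubic-bound : ∀ a b c d n → 1 ≤ n → a + b * n + c * (n * n) + d * (n * n * n) ≤ (a + b + c + d) * n ^ 3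
cubic-bound a b c d n@(suc _) _ = begin
  a + b * n + c * (n * n) + d * (n * n * n)
    ≡⟨ powers a b c d n ⟩
  a * n ^ 0 + b * n ^ 1 + c * n ^ 2 + d * n ^ 3
    ≤⟨ +-monoˡ-≤ _ (+-mono-≤ (+-mono-≤ (scale a z≤n) (scale b (s≤s z≤n))) (scale c (s≤s (s≤s z≤n)))) ⟩
  a * n ^ 3 + b * n ^ 3 + c * n ^ 3 + d * n ^ 3
    ≡⟨ factor a b c d (n ^ 3) ⟩
  (a + b + c + d) * n ^ 3  ∎
  where
  open ≤-Reasoning

  scale : ∀ a {i} → i ≤ 3 → a * n ^ i ≤ a * n ^ 3
  scale a i≤3 = *-monoʳ-≤ a (^-monoʳ-≤ n i≤3)

  -- The right-hand side is what `n ^ 0` to `n ^ 3` unfold to by computation.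
  powers : ∀ a b c d n → a + b * n + c * (n * n) + d * (n * n * n)
                       ≡ a * 1 + b * (n * 1) + c * (n * (n * 1)) + d * (n * (n * (n * 1)))
  powers = solve-∀

  factor : ∀ a b c d x → a * x + b * x + c * x + d * x ≡ (a + b + c + d) * x
  factor = solve-∀

proposition1 : ∃₂ λ (C n₀ : ℕ) →
    ∀ (n : ℕ) → n₀ ≤ n →
    ∀ (G : Graph n) (f : Vector Label n) (σ : Memory n) →
    Execution.HaltsWithin G f (C * n ^ 3) (start extRDSolver σ)
-- The constant is `31 + 72 + 53 + 7`; order 0 is excluded because `0 ^ 3` cannot absorb the
-- constant cost.
proposition1 = 163 , 1 , λ n 1≤n G f σ execution →
  let cost≤ , progress = extRDSolver-haltsWithin G f σ execution
  in ≤-trans cost≤ (cubic-bound 31 72 53 7 n 1≤n) , progress
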